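{- There is a constant $C$ such that for all sufficiently large $n$ the following holds: if $G$ is a graph with at most $\left(2+\frac{43}{651}\right)n - C$ edges, then there exists a red/blue coloring of $E(G)$ such that the red graph is acyclic and the blue graph contains no path on $n$ vertices. Consequently, for all sufficiently large $n$, \[2.066n < \left(2+\tfrac{43}{651}\right)n - C \le \hat{R}(\mathcal{C}, P_n).\]
   Context: $P_n$ denotes the path on $n$ vertices and $\mathcal{C}$ the family of all cycles. $G\to(\mathcal{C},P_n)$ means every red/blue coloring of $E(G)$ contains a red cycle or a blue $P_n$; $\hat{R}(\mathcal{C},P_n)=\min\{|E(G)| : G\to(\mathcal{C},P_n)\}$. -}

module Defs where

open import Data.Nat using (ℕ; zero; suc; _+_; _*_; _≤_; _<_)
open import Data.Fin using (Fin; toℕ)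
open import Data.Bool using (Bool; true; false)
open import Data.List using (List; []; _∷_; length; lookup)
open import Data.List.Relation.Unary.Unique.Propositional using (Unique)
open import Data.List.Relation.Unary.All using (All)
open import Data.Product using (_×_; _,_; ∃-syntax; Σ-syntax)
open import Data.Sum using (_⊎_)
open import Data.Empty using (⊥)
open import Data.Unit using (⊤)
open import Relation.Nullary using (¬_)
open import Relation.Binary.PropositionalEquality using (_≡_)

-- A finite simple graph: vertex set Fin V, edge set given as a duplicate-free
-- list of pairs (u , v) with toℕ u < toℕ v (so each unordered edge occurs once,
-- no loops, no multi-edges).
record Graph : Set where
  field
    V        : ℕ
    edges    : List (Fin V × Fin V)
    ordered  : All (λ e → toℕ (Data.Product.proj₁ e) < toℕ (Data.Product.proj₂ e)) edges
    distinct : Unique edges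
open Graph public

∣E∣ : Graph → ℕ
∣E∣ G = length (edges G)

-- A red/blue coloring of E(G): each edge (indexed by its position) gets a colour.
-- true = red, false = blue.
Coloring : Graph → Set
Coloring G = Fin (∣E∣ G) → Bool

Adj : (G : Graph) → Coloring G → Bool → Fin (V G) → Fin (V G) → Set
Adj G c b u v = ∃[ i ] ((lookup (edges G) i ≡ (u , v) ⊎ lookup (edges G) i ≡ (v , u)) × c i ≡ b)

Walk : (G : Graph) → Coloring G → Bool → List (Fin (V G)) → Set
Walk G c b []             = ⊤
Walk G c b (x ∷ [])       = ⊤
Walk G c b (x ∷ y ∷ rest) = Adj G c b x y × Walk G c b (y ∷ rest)

PathOn : (G : Graph) → Coloring G → Bool → ℕ → Set
PathOn G c b n = Σ[ p ∈ List (Fin (V G)) ]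
  (length p ≡ n × Unique p × Walk G c b p)

LastAdj : (G : Graph) → Coloring G → Bool → Fin (V G) → List (Fin (V G)) → Set
LastAdj G c b v₀ []          = ⊥
LastAdj G c b v₀ (x ∷ [])    = Adj G c b x v₀
LastAdj G c b v₀ (x ∷ y ∷ r) = LastAdj G c b v₀ (y ∷ r)

CycleIn : (G : Graph) → Coloring G → Bool → Set
CycleIn G c b = Σ[ v₀ ∈ Fin (V G) ] Σ[ p ∈ List (Fin (V G)) ]
  (3 ≤ length (v₀ ∷ p) × Unique (v₀ ∷ p) × Walk G c b (v₀ ∷ p)
    × LastAdj G c b v₀ p)

red blue : Bool
red  = true
blue = false

Arrows : Graph → ℕ → Set
Arrows G n = (c : Coloring G) → CycleIn G c red ⊎ PathOn G c blue n

{-# OPTIONS --safe #-}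
module Submission where

-- Colour red a spanning forest found by Kruskal's algorithm, with a suitable priority
-- among the edges, and suppose that there is a blue path P on n vertices.
--
-- Let S be an independent set of non-isolated vertices whose stars form a forest, put
-- L = N(S), and let σ be the sum of the degrees over S, so that |L| ≤ σ.  Give priority to
-- the edges that miss L, then to the stars of S (which are disjoint from these), then to
-- the rest.  The stars are red, so P avoids S.
--   * P with one edge at each vertex of S is a forest, so there are at least n - 1 + |S|
--     red edges, and 2(n - 1) + |S| ≤ m.
--   * At least n - 1 - 2σ edges of P miss L, and by priority as many red edges miss L.
--   * Let S be maximal among the sets chosen greedily from the vertices of degree ≤ j, where
--     v is accepted if it is outside S ∪ L and sends at most one edge to L.  Then every
--     vertex of P of degree ≤ j outside L sends two edges to L, while the stars of S
--     account for σ more such edges.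
-- Adding up, 4n ≤ m + 5σ + 2 g(j) + 2, where g(j) is the number of vertices of degree > j.
-- Growing S through j = 2, 4, 7 and combining the three bounds with weights 3, 2, 3, for
-- which 3 g(2) + 2 g(4) + 3 g(7) ≤ 2m, yields 242 n ≤ 117 m + 226.  Since
-- 242/117 > 1345/651, one of the colourings has no blue path if n ≥ 1000, even with C = 0.

open import Defs
open import Data.Bool using (Bool; true; false; if_then_else_)
open import Data.Empty using (⊥-elim)
open import Data.Fin using (Fin)
open import Data.Fin.Properties using (_≟_)
open import Data.List using (List; []; _∷_; length; lookup; _++_; map; filter; concatMap; allFin)
open import Data.List.Properties using (length-map; length-++; length-tabulate; filter-all; filter-some; concatMap-++; ++-assoc)
open import Data.List.Membership.Propositional using (_∈_; _∉_; find; lose)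
open import Data.List.Membership.Propositional.Properties
  using (∈-map⁺; ∈-map⁻; ∈-++⁺ˡ; ∈-++⁺ʳ; ∈-++⁻; ∈-filter⁺; ∈-filter⁻; ∈-allFin; ∈-concatMap⁺; ∈-concatMap⁻; ∈-lookup)
open import Data.List.Relation.Binary.Subset.Propositional using (_⊆_)
open import Data.List.Relation.Unary.All using (All; []; _∷_)
import Data.List.Relation.Unary.All as All
open import Data.List.Relation.Unary.AllPairs using ([]; _∷_)
open import Data.List.Relation.Unary.Any using (here; there; _─_)
open import Data.List.Relation.Unary.Unique.Propositional using (Unique)
import Data.List.Relation.Unary.Unique.Propositional.Properties as Unique
open import Data.Nat using (ℕ; suc; _+_; _*_; _≤_; _<_; _≥_; z≤n; s≤s; _≤?_; _<?_; >-nonZero)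
open import Data.Nat.ListAction using (sum)
open import Data.Nat.Properties hiding (_≟_)
open import Data.Nat.Tactic.RingSolver using (solve-∀)
open import Data.Product using (_×_; _,_; proj₁; proj₂; ∃-syntax)
open import Data.Product.Properties using (≡-dec)
open import Data.Sum using (_⊎_; inj₁; inj₂; [_,_]; map₁; swap)
open import Data.Unit using (⊤; tt)
open import Function using (_∘_)
open import Level using (Level)
open import Relation.Binary.PropositionalEquality using (_≡_; _≢_; refl; sym; trans; cong; cong₂; subst; ≢-sym)
open import Relation.Nullary using (¬_; Dec; yes; no; does; ¬?; contradiction; _×-dec_; _⊎-dec_)
open import Relation.Nullary.Decidable using (dec-true; dec-false; decidable-stable; map′)
open import Relation.Unary using (Pred; Decidable)

-- Counting with duplicate-free lists.

module Lists where

  private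
    variable
      a p : Level
      A : Set a
      x y : A
      xs ys : List A

  ─-⊆ : (x∈ : x ∈ ys) → y ∈ ys → y ≢ x → y ∈ (ys ─ x∈)
  ─-⊆ (here refl) (here refl) y≢x = contradiction refl y≢x
  ─-⊆ (here refl) (there y∈)  y≢x = y∈
  ─-⊆ (there x∈)  (here refl) y≢x = here refl
  ─-⊆ (there x∈)  (there y∈)  y≢x = there (─-⊆ x∈ y∈ y≢x)

  length-─ : (x∈ : x ∈ ys) → length ys ≡ suc (length (ys ─ x∈))
  length-─ (here _)   = refl
  length-─ (there x∈) = cong suc (length-─ x∈)

  Unique-⊆⇒length≤ : Unique xs → xs ⊆ ys → length xs ≤ length ys
  Unique-⊆⇒length≤ []          xs⊆ = z≤n
  Unique-⊆⇒length≤ (x∉ ∷ uniq) xs⊆ =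
    subst (_ ≤_) (sym (length-─ (xs⊆ (here refl))))
      (s≤s (Unique-⊆⇒length≤ uniq λ y∈ → ─-⊆ (xs⊆ (here refl)) (xs⊆ (there y∈)) (≢-sym (All.lookup x∉ y∈))))

  fresh-∷ : x ∉ xs → Unique xs → Unique (x ∷ xs)
  fresh-∷ x∉ u = All.tabulate (λ { y∈ refl → x∉ y∈ }) ∷ u

  length-filter-¬ : {P : Pred A p} (P? : Decidable P) (xs : List A) →
    length xs ≡ length (filter P? xs) + length (filter (¬? ∘ P?) xs)
  length-filter-¬ P? []       = refl
  length-filter-¬ P? (x ∷ xs) with P? x
  ... | yes _ = cong suc (length-filter-¬ P? xs)
  ... | no  _ = trans (cong suc (length-filter-¬ P? xs)) (sym (+-suc _ _))

  indicator : {P : Set p} → Dec P → ℕ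
  indicator P? = if does P? then 1 else 0

  length-filter-∷ : {P : Pred A p} (P? : Decidable P) (x : A) (xs : List A) →
    length (filter P? (x ∷ xs)) ≡ indicator (P? x) + length (filter P? xs)
  length-filter-∷ P? x xs with does (P? x)
  ... | true  = refl
  ... | false = refl

  length≤1⇒≡ : length xs ≤ 1 → x ∈ xs → y ∈ xs → x ≡ y
  length≤1⇒≡ {xs = _ ∷ []} _ (here refl) (here refl) = refl
  length≤1⇒≡ {xs = _ ∷ _ ∷ _} (s≤s ())

  twice-suc : ∀ {l} q b → l ≤ q + 2 * b → suc (suc l) ≤ q + 2 * suc b
  twice-suc q b l≤ = ≤-trans (s≤s (s≤s l≤)) (≤-reflexive (eq q b))
    where
    eq : ∀ q b → 2 + (q + 2 * b) ≡ q + 2 * suc b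
    eq = solve-∀

open Lists

-- Kruskal's algorithm: components and forests.

Edge : ℕ → Set
Edge V = Fin V × Fin V

Ends : ∀ {V} → Edge V → Fin V → Fin V → Set
Ends e x y = e ≡ (x , y) ⊎ e ≡ (y , x)

module Kruskal {V : ℕ} where

  open import Data.List.Membership.DecPropositional (_≟_ {V}) using (_∈?_)

  relabel : Fin V → Fin V → Fin V → Fin V
  relabel a b y = if does (y ≟ b) then a else y

  relabel-to : ∀ a b → relabel a b b ≡ a
  relabel-to a b rewrite dec-true (b ≟ b) refl = refl

  relabel-from : ∀ a b → relabel a b a ≡ a
  relabel-from a b with a ≟ b
  ... | yes _ = refl
  ... | no  _ = refl

  relabel-≢ : ∀ {a b y} → y ≢ b → relabel a b y ≡ y
  relabel-≢ {a} {b} {y} y≢b rewrite dec-false (y ≟ b) y≢b = refl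

  relabel-refl : ∀ {a b} y → a ≡ b → relabel a b y ≡ y
  relabel-refl {a} {b} y refl with y ≟ a
  ... | yes refl = refl
  ... | no  _    = refl

  -- Edges are processed from the end of the list, so that a suffix of the list has priority.
  label : List (Edge V) → Fin V → Fin V
  label []       x = x
  label (e ∷ es) x = relabel (label es (proj₁ e)) (label es (proj₂ e)) (label es x)

  Constant : {B : Set} → (Fin V → B) → Edge V → Set
  Constant f e = f (proj₁ e) ≡ f (proj₂ e)

  label-constant : ∀ {es e} → e ∈ es → Constant (label es) e
  label-constant {e ∷ es} (here refl) = trans (relabel-from a b) (sym (relabel-to a b))
    where
    a = label es (proj₁ e)
    b = label es (proj₂ e)
  label-constant {e' ∷ es} (there e∈) = cong (relabel (label es (proj₁ e')) (label es (proj₂ e'))) (label-constant e∈)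

  -- A label is a vertex of the component that it names: `relabel` only replaces the label of one
  -- end of `e` by that of the other, and `f` takes the same value on both because it agrees on the
  -- ends of `e`.
  label-finest : {B : Set} (f : Fin V → B) → ∀ es → (∀ {e} → e ∈ es → Constant f e) → ∀ x → f (label es x) ≡ f x
  label-finest f []       c x = refl
  label-finest f (e ∷ es) c x with label es x ≟ label es (proj₂ e)
  ... | no  _  = label-finest f es (c ∘ there) x
  ... | yes eq = trans (ih (proj₁ e)) (trans (c (here refl)) (trans (sym (ih (proj₂ e))) (trans (cong f (sym eq)) (ih x))))
    where ih = label-finest f es (c ∘ there)

  -- The tool for showing that an edge is accepted: a function that is constant on the processed
  -- edges but differs at two vertices certifies that these lie in different components.
  label-separate : {B : Set} (f : Fin V → B) → ∀ es → (∀ {e} → e ∈ es → Constant f e) →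
    ∀ {x y} → f x ≢ f y → label es x ≢ label es y
  label-separate f es c {x} {y} fx≢fy eq =
    fx≢fy (trans (sym (label-finest f es c x)) (trans (cong f eq) (label-finest f es c y)))

  kruskal : List (Edge V) → List (Edge V)
  kruskal []       = []
  kruskal (e ∷ es) with label es (proj₁ e) ≟ label es (proj₂ e)
  ... | yes _ = kruskal es
  ... | no  _ = e ∷ kruskal es

  kruskal-⊆ : ∀ es → kruskal es ⊆ es
  kruskal-⊆ (e ∷ es) e∈ with label es (proj₁ e) ≟ label es (proj₂ e)
  kruskal-⊆ (e ∷ es) e∈          | yes _ = there (kruskal-⊆ es e∈)
  kruskal-⊆ (e ∷ es) (here refl) | no  _ = here refl
  kruskal-⊆ (e ∷ es) (there e∈)  | no  _ = there (kruskal-⊆ es e∈)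

  kruskal-∷ : ∀ e es → kruskal es ⊆ kruskal (e ∷ es)
  kruskal-∷ e es e∈ with label es (proj₁ e) ≟ label es (proj₂ e)
  ... | yes _ = e∈
  ... | no  _ = there e∈

  kruskal-++ʳ : ∀ es {fs} → kruskal fs ⊆ kruskal (es ++ fs)
  kruskal-++ʳ []       f∈ = f∈
  kruskal-++ʳ (e ∷ es) f∈ = kruskal-∷ e (es ++ _) (kruskal-++ʳ es f∈)

  kruskal-accept : ∀ e es → label es (proj₁ e) ≢ label es (proj₂ e) → e ∈ kruskal (e ∷ es)
  kruskal-accept e es new with label es (proj₁ e) ≟ label es (proj₂ e)
  ... | yes eq = contradiction eq new
  ... | no  _  = here refl

  kruskal-unique : ∀ es → Unique (kruskal es)
  kruskal-unique []       = []
  kruskal-unique (e ∷ es) with label es (proj₁ e) ≟ label es (proj₂ e)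
  ... | yes _ = kruskal-unique es
  ... | no  new = fresh-∷ (λ e∈ → new (label-constant (kruskal-⊆ es e∈))) (kruskal-unique es)

  -- One representative of each component, so that the length counts components.
  roots : List (Edge V) → List (Fin V)
  roots es = filter (λ x → label es x ≟ x) (allFin V)

  roots-unique : ∀ es → Unique (roots es)
  roots-unique es = Unique.filter⁺ (λ x → label es x ≟ x) (Unique.allFin⁺ V)

  ∈-roots⁺ : ∀ {es x} → label es x ≡ x → x ∈ roots es
  ∈-roots⁺ {es} = ∈-filter⁺ (λ x → label es x ≟ x) (∈-allFin _)

  ∈-roots⁻ : ∀ {es x} → x ∈ roots es → label es x ≡ x
  ∈-roots⁻ {es} x∈ = proj₂ (∈-filter⁻ (λ x → label es x ≟ x) {xs = allFin V} x∈)

  -- An accepted edge costs at most one root, namely the label of its second end; a rejected edge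
  -- costs none.
  kruskal-roots : ∀ es → V ≤ length (kruskal es) + length (roots es)
  kruskal-roots [] = subst (_≤ length (roots [])) (length-tabulate {n = V} (λ i → i))
    (Unique-⊆⇒length≤ (Unique.allFin⁺ V) (λ _ → ∈-roots⁺ {[]} refl))
  kruskal-roots (e ∷ es) with label es (proj₁ e) ≟ label es (proj₂ e)
  ... | yes eq = ≤-trans (kruskal-roots es) (+-monoʳ-≤ (length (kruskal es)) (Unique-⊆⇒length≤ (roots-unique es)
        λ x∈ → ∈-roots⁺ {e ∷ es} (trans (relabel-refl _ eq) (∈-roots⁻ {es} x∈))))
  ... | no  _  = ≤-trans (kruskal-roots es) (≤-trans (+-monoʳ-≤ (length (kruskal es)) shrink) (≤-reflexive (+-suc _ _)))
    where
    step : roots es ⊆ label es (proj₂ e) ∷ roots (e ∷ es)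
    step {x} x∈ with x ≟ label es (proj₂ e)
    ... | yes refl = here refl
    ... | no  x≢   = there (∈-roots⁺ {e ∷ es} (trans (cong (relabel _ _) (∈-roots⁻ {es} x∈)) (relabel-≢ x≢)))
    shrink : length (roots es) ≤ suc (length (roots (e ∷ es)))
    shrink = Unique-⊆⇒length≤ (roots-unique es) step

  -- The vertices z are the lower ends of a forest whose edges join equally labelled vertices;
  -- the parent of z is absent from the rest of the list.
  data Hanging (ℓ : Fin V → Fin V) : List (Fin V) → Set where
    []  : Hanging ℓ []
    add : ∀ {z zs} q → q ∉ z ∷ zs → z ∉ zs → ℓ q ≡ ℓ z → Hanging ℓ zs → Hanging ℓ (z ∷ zs)

  hanging-unique : ∀ {ℓ zs} → Hanging ℓ zs → Unique zs
  hanging-unique []               = []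
  hanging-unique (add _ _ z∉ _ h) = fresh-∷ z∉ (hanging-unique h)

  -- If the vertex found for the tail is the new `z`, its parent `q` replaces it; as `q` lies
  -- outside the whole list, one step up suffices.
  ascend : ∀ {ℓ zs} → Hanging ℓ zs → ∀ x → ∃[ w ] (w ∉ zs × ℓ w ≡ ℓ x)
  ascend [] x = x , (λ ()) , refl
  ascend (add {z} q q∉ z∉ ℓq≡ℓz h) x with ascend h x
  ... | w , w∉ , ℓw≡ℓx with w ≟ z
  ...   | yes refl = q , q∉ , trans ℓq≡ℓz ℓw≡ℓx
  ...   | no  w≢z  = w , (λ { (here w≡z) → w≢z w≡z ; (there w∈) → w∉ w∈ }) , ℓw≡ℓx

  -- By `ascend`, every component has a vertex outside `zs`, so there are at most `V` minus
  -- `length zs` components; `kruskal-roots` turns this into a lower bound for the accepted edges.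
  hanging-length≤ : ∀ es {zs} → Hanging (label es) zs → length zs ≤ length (kruskal es)
  hanging-length≤ es {zs} h = +-cancelʳ-≤ (length (roots es)) _ _ (≤-trans bound (kruskal-roots es))
    where
    rest = filter (λ x → ¬? (x ∈? zs)) (allFin V)
    rest-unique : Unique rest
    rest-unique = Unique.filter⁺ (λ x → ¬? (x ∈? zs)) (Unique.allFin⁺ V)
    roots⊆ : roots es ⊆ map (label es) rest
    roots⊆ {x} x∈ with ascend h x
    ... | w , w∉ , eq = subst (_∈ map (label es) rest) (trans eq (∈-roots⁻ {es} x∈))
      (∈-map⁺ (label es) (∈-filter⁺ (λ x → ¬? (x ∈? zs)) (∈-allFin w) w∉))
    disjoint : Unique (zs ++ rest)
    disjoint = Unique.++⁺ (hanging-unique h) rest-unique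
      λ { (x∈ , x∈') → proj₂ (∈-filter⁻ (λ x → ¬? (x ∈? zs)) {xs = allFin V} x∈') x∈ }
    bound : length zs + length (roots es) ≤ V
    bound = ≤-trans (+-monoʳ-≤ (length zs)
      (≤-trans (Unique-⊆⇒length≤ (roots-unique es) roots⊆) (≤-reflexive (length-map (label es) rest))))
      (≤-trans (≤-reflexive (sym (length-++ zs)))
        (≤-trans (Unique-⊆⇒length≤ disjoint λ _ → ∈-allFin _) (≤-reflexive (length-tabulate {n = V} (λ i → i)))))

  -- Paths in an edge list, and acyclicity of the Kruskal forest.

  Joined : List (Edge V) → Fin V → Fin V → Set
  Joined es x y = ∃[ e ] (e ∈ es × Ends e x y)

  Chain : List (Edge V) → List (Fin V) → Set
  Chain es []           = ⊤
  Chain es (x ∷ [])     = ⊤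
  Chain es (x ∷ y ∷ xs) = Joined es x y × Chain es (y ∷ xs)

  last : Fin V → List (Fin V) → Fin V
  last x []       = x
  last x (y ∷ ys) = last y ys

  last-∈ : ∀ x ys → last x ys ∈ x ∷ ys
  last-∈ x []       = here refl
  last-∈ x (y ∷ ys) = there (last-∈ y ys)

  joined-constant : {B : Set} (f : Fin V → B) → ∀ {es x y} → (∀ {e} → e ∈ es → Constant f e) → Joined es x y → f x ≡ f y
  joined-constant f c (_ , e∈ , inj₁ refl) = c e∈
  joined-constant f c (_ , e∈ , inj₂ refl) = sym (c e∈)

  chain-constant : {B : Set} (f : Fin V → B) → ∀ {es} x ys → (∀ {e} → e ∈ es → Constant f e) → Chain es (x ∷ ys) → f x ≡ f (last x ys)
  chain-constant f x []       c _       = refl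
  chain-constant f x (y ∷ ys) c (j , w) = trans (joined-constant f c j) (chain-constant f y ys c w)

  split-joined : ∀ {e es x y} → Joined (e ∷ es) x y → Ends e x y ⊎ Joined es x y
  split-joined (_ , here refl , ends) = inj₁ ends
  split-joined (e , there e∈  , ends) = inj₂ (e , e∈ , ends)

  chain-avoid : ∀ {e es} q x ys → (∀ {x y} → Ends e x y → x ≡ q ⊎ y ≡ q) → q ∉ x ∷ ys → Chain (e ∷ es) (x ∷ ys) → Chain es (x ∷ ys)
  chain-avoid q x []       _  _  _ = tt
  chain-avoid q x (y ∷ ys) at q∉ (j , w) with split-joined j
  ... | inj₂ j' = j' , chain-avoid q y ys at (q∉ ∘ there) w
  ... | inj₁ ends with at ends
  ...   | inj₁ refl = contradiction (here refl) q∉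
  ...   | inj₂ refl = contradiction (there (here refl)) q∉

  ends-meet : ∀ {e : Edge V} {a b x y} → Ends e a b → Ends e x y → (x ≡ a × y ≡ b) ⊎ (x ≡ b × y ≡ a)
  ends-meet (inj₁ refl) (inj₁ refl) = inj₁ (refl , refl)
  ends-meet (inj₁ refl) (inj₂ refl) = inj₂ (refl , refl)
  ends-meet (inj₂ refl) (inj₁ refl) = inj₂ (refl , refl)
  ends-meet (inj₂ refl) (inj₂ refl) = inj₁ (refl , refl)

  ends-left : ∀ {e : Edge V} {a b} → Ends e a b → ∀ {x y} → Ends e x y → x ≡ a ⊎ y ≡ a
  ends-left ab xy with ends-meet ab xy
  ... | inj₁ (eq , _) = inj₁ eq
  ... | inj₂ (_ , eq) = inj₂ eq

  -- A path with distinct vertices runs through the edge e at most once.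
  chain-split : ∀ {e es} (f : Fin V → Fin V) x ys → (∀ {e} → e ∈ es → Constant f e) → Unique (x ∷ ys) → Chain (e ∷ es) (x ∷ ys) →
    Chain es (x ∷ ys) ⊎ ∃[ a ] ∃[ b ] (Ends e a b × f x ≡ f a × f b ≡ f (last x ys))
  chain-split f x []       c _ _ = inj₁ tt
  chain-split f x (y ∷ ys) c (x∉ ∷ u) (j , w) with split-joined j
  ... | inj₁ ends = inj₂ (x , y , ends , refl ,
          chain-constant f y ys c (chain-avoid x y ys (ends-left ends) (λ x∈ → All.lookup x∉ x∈ refl) w))
  ... | inj₂ j' with chain-split f y ys c u w
  ...   | inj₁ w' = inj₁ (j' , w')
  ...   | inj₂ (a , b , ends , fy , fl) = inj₂ (a , b , ends , trans (joined-constant f c j') fy , fl)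

  -- On a cycle through the newest edge `e`, the other edges form a path of older edges between the
  -- ends of `e`. These ends then had equal labels already, and `e` would have been rejected.
  kruskal-acyclic : ∀ es x ys → 3 ≤ length (x ∷ ys) → Unique (x ∷ ys) → Chain (kruskal es) (x ∷ ys) → ¬ Joined (kruskal es) (last x ys) x
  kruskal-acyclic []       x ys 3≤ u w (_ , () , _)
  kruskal-acyclic (e ∷ es) x ys 3≤ u w j with label es (proj₁ e) ≟ label es (proj₂ e)
  ... | yes _ = kruskal-acyclic es x ys 3≤ u w j
  ... | no  new = body ys 3≤ u w j
    where
    f = label es
    const : ∀ {e} → e ∈ kruskal es → Constant f e
    const e∈ = label-constant (kruskal-⊆ es e∈)
    distinguishes : ∀ {a b} → Ends e a b → f a ≢ f b
    distinguishes (inj₁ refl) = new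
    distinguishes (inj₂ refl) = new ∘ sym
    body : ∀ ys → 3 ≤ length (x ∷ ys) → Unique (x ∷ ys) → Chain (e ∷ kruskal es) (x ∷ ys) → ¬ Joined (e ∷ kruskal es) (last x ys) x
    body [] (s≤s ())
    body (_ ∷ []) (s≤s (s≤s ()))
    body (y ∷ z ∷ ys) 3≤ u@((x≢y ∷ x∉) ∷ y∉ ∷ _) w@(k , w') j with split-joined j
    ... | inj₂ j' with chain-split f x (y ∷ z ∷ ys) const u w
    ...   | inj₁ v = kruskal-acyclic es x (y ∷ z ∷ ys) 3≤ u v j'
    ...   | inj₂ (a , b , ends , fx , fl) = distinguishes ends (trans (sym fx) (trans (sym (joined-constant f const j')) (sym fl)))
    body (y ∷ z ∷ ys) 3≤ u@((x≢y ∷ x∉) ∷ y∉ ∷ _) w@(k , w') j | inj₁ ends with split-joined k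
    -- The newest edge would be both the closing edge and the first step, so the last vertex would
    -- be `x` or `y`, against distinctness.
    ...   | inj₁ ends' with ends-meet ends ends'
    ...     | inj₁ (eq , _) = All.lookup x∉ (last-∈ z ys) eq
    ...     | inj₂ (_ , eq) = All.lookup y∉ (last-∈ z ys) eq
    -- Only the closing edge is new: from `y` on, the path avoids `x` and hence uses older edges.
    body (y ∷ z ∷ ys) 3≤ u@((x≢y ∷ x∉) ∷ y∉ ∷ _) w@(k , w') j | inj₁ ends | inj₂ k' =
      distinguishes ends (sym (trans (joined-constant f const k')
        (chain-constant f y (z ∷ ys) const (chain-avoid x y (z ∷ ys) (ends-left (swap ends)) (λ x∈ → All.lookup (x≢y ∷ x∉) x∈ refl) w'))))

-- Neighbours, stars and degrees.

module Greedy (G : Graph) where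

  open Kruskal {V G}
  open import Data.List.Membership.DecPropositional (_≟_ {V G}) using (_∈?_)
  open import Data.List.Membership.DecPropositional (≡-dec (_≟_ {V G}) (_≟_ {V G})) using () renaming (_∈?_ to _∈E?_)

  Vertex : Set
  Vertex = Fin (V G)

  E : List (Edge (V G))
  E = edges G

  private
    variable
      e e' : Edge (V G)
      u v x y z : Vertex
      S L : List Vertex

  Incident : Vertex → Edge (V G) → Set
  Incident v e = v ≡ proj₁ e ⊎ v ≡ proj₂ e

  incident? : ∀ v → Decidable (Incident v)
  incident? v e = (v ≟ proj₁ e) ⊎-dec (v ≟ proj₂ e)

  other : Vertex → Edge (V G) → Vertex
  other v e = if does (v ≟ proj₁ e) then proj₂ e else proj₁ e

  other-ends : Incident v e → Ends e v (other v e)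
  other-ends {v} {e} v∈e with v ≟ proj₁ e
  other-ends _           | yes refl = inj₁ refl
  other-ends (inj₁ eq)   | no  v≢   = contradiction eq v≢
  other-ends (inj₂ refl) | no  _    = inj₂ refl

  ends-incident : Ends e x y → Incident x e
  ends-incident (inj₁ refl) = inj₁ refl
  ends-incident (inj₂ refl) = inj₂ refl

  incident-ends : Ends e x y → Incident z e → z ≡ x ⊎ z ≡ y
  incident-ends (inj₁ refl) i = i
  incident-ends (inj₂ refl) i = swap i

  loopless : e ∈ E → Ends e x y → x ≢ y
  loopless e∈ (inj₁ refl) refl = <-irrefl refl (All.lookup (ordered G) e∈)
  loopless e∈ (inj₂ refl) refl = <-irrefl refl (All.lookup (ordered G) e∈)

  -- Pairs are stored in increasing order, so the two orientations of an edge cannot both occur in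
  -- `E`.
  simple : e ∈ E → e' ∈ E → Ends e x y → Ends e' x y → e ≡ e'
  simple e∈ e'∈ (inj₁ refl) (inj₁ refl) = refl
  simple e∈ e'∈ (inj₁ refl) (inj₂ refl) = contradiction (All.lookup (ordered G) e'∈) (<-asym (All.lookup (ordered G) e∈))
  simple e∈ e'∈ (inj₂ refl) (inj₁ refl) = contradiction (All.lookup (ordered G) e'∈) (<-asym (All.lookup (ordered G) e∈))
  simple e∈ e'∈ (inj₂ refl) (inj₂ refl) = refl

  ends-other : e ∈ E → Ends e x y → other x e ≡ y
  ends-other e∈ ends with ends-meet ends (other-ends (ends-incident ends))
  ... | inj₁ (_ , eq) = eq
  ... | inj₂ (eq , _) = contradiction eq (loopless e∈ ends)

  star : Vertex → List (Edge (V G))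
  star v = filter (incident? v) E

  nbrs : Vertex → List Vertex
  nbrs v = map (other v) (star v)

  deg : Vertex → ℕ
  deg v = length (star v)

  ∈-star⁺ : e ∈ E → Ends e v u → e ∈ star v
  ∈-star⁺ e∈ ends = ∈-filter⁺ (incident? _) e∈ (ends-incident ends)

  ∈-star⁻ : e ∈ star v → e ∈ E × Ends e v (other v e)
  ∈-star⁻ {v = v} e∈ with ∈-filter⁻ (incident? v) {xs = E} e∈
  ... | e∈E , i = e∈E , other-ends i

  star-unique : ∀ v → Unique (star v)
  star-unique v = Unique.filter⁺ (incident? v) (distinct G)

  ∈-nbrs⁺ : e ∈ E → Ends e v u → u ∈ nbrs v
  ∈-nbrs⁺ {v = v} e∈ ends = subst (_∈ nbrs v) (ends-other e∈ ends) (∈-map⁺ (other v) (∈-star⁺ e∈ ends))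

  ∈-nbrs⁻ : u ∈ nbrs v → ∃[ e ] (e ∈ E × Ends e v u)
  ∈-nbrs⁻ {v = v} u∈ with ∈-map⁻ (other v) u∈
  ... | e , e∈ , refl = e , ∈-star⁻ e∈

  nbrs-sym : u ∈ nbrs v → v ∈ nbrs u
  nbrs-sym u∈ with ∈-nbrs⁻ u∈
  ... | _ , e∈ , ends = ∈-nbrs⁺ e∈ (swap ends)

  -- Repetitions are kept on purpose: the length is then the degree sum σ over `S`, an upper bound
  -- for the size of the neighbourhood.
  N : List Vertex → List Vertex
  N = concatMap nbrs

  stars : List Vertex → List (Edge (V G))
  stars = concatMap star

  length-N : ∀ S → length (N S) ≡ length (stars S)
  length-N []      = refl
  length-N (v ∷ S) = trans (length-++ (nbrs v)) (trans (cong₂ _+_ (length-map (other v) (star v)) (length-N S)) (sym (length-++ (star v))))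

  ∈-N⁺ : v ∈ S → u ∈ nbrs v → u ∈ N S
  ∈-N⁺ v∈ u∈ = ∈-concatMap⁺ nbrs (lose v∈ u∈)

  ∈-stars⁻ : e ∈ stars S → ∃[ s ] (s ∈ S × e ∈ star s)
  ∈-stars⁻ {S = S} e∈ = find (∈-concatMap⁻ star {xs = S} e∈)

  -- Good sets, whose stars form a forest.

  edgesInto : Vertex → List Vertex → List (Edge (V G))
  edgesInto v L = filter (λ e → other v e ∈? L) (star v)

  ∈-edgesInto⁺ : e ∈ E → Ends e v u → u ∈ L → e ∈ edgesInto v L
  ∈-edgesInto⁺ {v = v} {L = L} e∈ ends u∈ =
    ∈-filter⁺ (λ e → other v e ∈? L) (∈-star⁺ e∈ ends) (subst (_∈ L) (sym (ends-other e∈ ends)) u∈)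

  ∈-edgesInto⁻ : e ∈ edgesInto v L → e ∈ star v × other v e ∈ L
  ∈-edgesInto⁻ {v = v} {L} = ∈-filter⁻ (λ e → other v e ∈? L) {xs = star v}

  edgesInto-unique : ∀ v L → Unique (edgesInto v L)
  edgesInto-unique v L = Unique.filter⁺ (λ e → other v e ∈? L) (star-unique v)

  -- `v∉N` keeps the set independent, `oneInto` prevents the star of `v` from closing a cycle with
  -- the earlier stars, and `deg≥1` supplies the edge by which `v` hangs in `good-hanging`.
  record Admissible (S : List Vertex) (v : Vertex) : Set where
    constructor admissible
    field
      v∉S     : v ∉ S
      v∉N     : v ∉ N S
      oneInto : length (edgesInto v (N S)) ≤ 1
      deg≥1   : 1 ≤ deg v
  open Admissible public

  -- The stars of the vertices of a good list form a forest: each star meets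
  -- the previous ones in at most one vertex.
  data Good : List Vertex → Set where
    []  : Good []
    _∷_ : Admissible S v → Good S → Good (v ∷ S)

  good-unique : Good S → Unique S
  good-unique []       = []
  good-unique (ad ∷ g) = fresh-∷ (v∉S ad) (good-unique g)

  -- Adjacency is symmetric, so `v∉N` at the moment of insertion excludes adjacency with the earlier
  -- vertices in both directions.
  good-disjoint : Good S → v ∈ S → v ∉ N S
  good-disjoint {S = w ∷ S} (ad ∷ g) v∈ v∈N with ∈-++⁻ (nbrs w) v∈N
  good-disjoint (ad ∷ g) (here refl) v∈N | inj₁ v∈w with ∈-nbrs⁻ v∈w
  ... | _ , e∈ , ends = loopless e∈ ends refl
  good-disjoint (ad ∷ g) (here refl) v∈N | inj₂ v∈' = v∉N ad v∈'
  good-disjoint (ad ∷ g) (there v∈)  v∈N | inj₁ v∈w = v∉N ad (∈-N⁺ v∈ (nbrs-sym v∈w))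
  good-disjoint (ad ∷ g) (there v∈)  v∈N | inj₂ v∈' = good-disjoint g v∈ v∈'

  Clear : List Vertex → Edge (V G) → Set
  Clear S e = ∀ {x} → Incident x e → x ∉ S × x ∉ N S

  constant⁺ : {B : Set} (f : Vertex → B) → Ends e x y → f x ≡ f y → Constant f e
  constant⁺ f (inj₁ refl) eq = eq
  constant⁺ f (inj₂ refl) eq = sym eq

  constant⁻ : {B : Set} (f : Vertex → B) → Ends e x y → Constant f e → f x ≡ f y
  constant⁻ f (inj₁ refl) eq = eq
  constant⁻ f (inj₂ refl) eq = sym eq

  separate⁺ : {B : Set} (f : Vertex → B) → Ends e x y → f x ≢ f y → f (proj₁ e) ≢ f (proj₂ e)
  separate⁺ f (inj₁ refl) = λ ≢ → ≢
  separate⁺ f (inj₂ refl) = λ ≢ → ≢ ∘ sym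

  differ : {a b : Bool} → a ≡ false → b ≡ true → a ≢ b
  differ refl refl ()

  module _ {b : List (Edge (V G))} where

    -- Here `b` holds the edges of highest priority and `es` the part of the star already processed.
    -- A Boolean function that is constant on all processed edges separates the ends `v` and `t` of
    -- the new edge.
    star-fresh : Admissible S v → (∀ {e} → e ∈ b → Clear (v ∷ S) e) →
      ∀ {es} → e ∈ star v → e ∉ es → es ⊆ star v →
      let fs = es ++ stars S ++ b in label fs (proj₁ e) ≢ label fs (proj₂ e)
    star-fresh {S} {v} {e} ad clear {es} e∈ e∉ es⊆ with ∈-star⁻ {v = v} e∈
    ... | e∈E , ends = separate⁺ (label fs) ends v≁t
      where
      fs = es ++ stars S ++ b
      t = other v e
      t∈N : t ∈ N (v ∷ S)
      t∈N = ∈-++⁺ˡ (∈-nbrs⁺ e∈E ends)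
      nbr∉S : ∀ {w} → w ∈ nbrs v → w ∉ S
      nbr∉S w∈ w∈S = v∉N ad (∈-N⁺ w∈S (nbrs-sym w∈))
      v≁t : label fs v ≢ label fs t
      v≁t with t ∈? N S
      -- No processed edge reaches `t`, so the indicator of `t` separates.
      ... | no t∉N = label-separate f fs const (differ (dec-false (v ≟ t) (loopless e∈E ends)) (dec-true (t ≟ t) refl))
        where
        f : Vertex → Bool
        f x = does (x ≟ t)
        const≢ : ∀ {e x y} → Ends e x y → x ≢ t → y ≢ t → Constant f e
        const≢ ends x≢ y≢ = constant⁺ f ends (trans (dec-false (_ ≟ t) x≢) (sym (dec-false (_ ≟ t) y≢)))
        const : ∀ {e} → e ∈ fs → Constant f e
        const {e'} e'∈ with ∈-++⁻ es e'∈
        ... | inj₁ e'∈es with ∈-star⁻ {v = v} (es⊆ e'∈es)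
        ...   | e'∈E , ends' = const≢ ends' (loopless e∈E ends)
                (λ eq → e∉ (subst (_∈ es) (simple e'∈E e∈E (subst (Ends e' v) eq ends') ends) e'∈es))
        const {e'} e'∈ | inj₂ e'∈' with ∈-++⁻ (stars S) e'∈'
        ... | inj₁ e'∈S with ∈-stars⁻ {S = S} e'∈S
        ...   | s , s∈ , e'∈s with ∈-star⁻ {v = s} e'∈s
        ...     | e'∈E , ends' = const≢ ends' (λ { refl → nbr∉S (∈-nbrs⁺ e∈E ends) s∈ })
                  (λ eq → t∉N (∈-N⁺ s∈ (subst (_∈ nbrs s) eq (∈-nbrs⁺ e'∈E ends'))))
        const {e'} e'∈ | inj₂ e'∈' | inj₂ e'∈b =
          const≢ (inj₁ refl) (λ eq → proj₂ (clear e'∈b (inj₁ (sym eq))) t∈N) (λ eq → proj₂ (clear e'∈b (inj₂ (sym eq))) t∈N)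
      -- The indicator of `S` and its neighbours separates: by `oneInto`, `e` is the only edge from
      -- `v` into `N S`, so the edges of `es` stay outside.
      ... | yes t∈ = label-separate f fs const (differ (f-false (v∉S ad) (v∉N ad)) (f-true (inj₂ t∈)))
        where
        f : Vertex → Bool
        f x = does (x ∈? (S ++ N S))
        f-false : ∀ {x} → x ∉ S → x ∉ N S → f x ≡ false
        f-false x∉S x∉N = dec-false (_ ∈? _) λ x∈ → [ x∉S , x∉N ] (∈-++⁻ S x∈)
        f-true : ∀ {x} → x ∈ S ⊎ x ∈ N S → f x ≡ true
        f-true (inj₁ x∈) = dec-true (_ ∈? _) (∈-++⁺ˡ x∈)
        f-true (inj₂ x∈) = dec-true (_ ∈? _) (∈-++⁺ʳ S x∈)
        const : ∀ {e} → e ∈ fs → Constant f e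
        const {e'} e'∈ with ∈-++⁻ es e'∈
        ... | inj₁ e'∈es with ∈-star⁻ {v = v} (es⊆ e'∈es)
        ...   | e'∈E , ends' = constant⁺ f ends' (trans (f-false (v∉S ad) (v∉N ad)) (sym (f-false (nbr∉S (∈-nbrs⁺ e'∈E ends'))
                λ w∈ → e∉ (subst (_∈ es) (length≤1⇒≡ (oneInto ad) (∈-edgesInto⁺ e'∈E ends' w∈) (∈-edgesInto⁺ e∈E ends t∈)) e'∈es))))
        const {e'} e'∈ | inj₂ e'∈' with ∈-++⁻ (stars S) e'∈'
        ... | inj₁ e'∈S with ∈-stars⁻ {S = S} e'∈S
        ...   | s , s∈ , e'∈s with ∈-star⁻ {v = s} e'∈s
        ...     | e'∈E , ends' = constant⁺ f ends' (trans (f-true (inj₁ s∈)) (sym (f-true (inj₂ (∈-N⁺ s∈ (∈-nbrs⁺ e'∈E ends'))))))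
        const {e'} e'∈ | inj₂ e'∈' | inj₂ e'∈b = trans (out (inj₁ refl)) (sym (out (inj₂ refl)))
          where
          out : ∀ {x} → Incident x e' → f x ≡ false
          out i = f-false (proj₁ (clear e'∈b i) ∘ there) (proj₂ (clear e'∈b i) ∘ ∈-++⁺ʳ (nbrs v))

    stars-accepted : Good S → (∀ {e} → e ∈ b → Clear S e) → stars S ⊆ kruskal (stars S ++ b)
    stars-accepted {v ∷ S} (ad ∷ g) clear {e} e∈ rewrite ++-assoc (star v) (stars S) b with ∈-++⁻ (star v) e∈
    ... | inj₂ e∈S = kruskal-++ʳ (star v) (stars-accepted g clear' e∈S)
      where
      clear' : ∀ {e} → e ∈ b → Clear S e
      clear' e∈ i = proj₁ (clear e∈ i) ∘ there , proj₂ (clear e∈ i) ∘ ∈-++⁺ʳ (nbrs v)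
    ... | inj₁ e∈v = star-accepted (star v) (star-unique v) (λ e∈ → e∈) e∈v
      where
      star-accepted : ∀ es → Unique es → es ⊆ star v → es ⊆ kruskal (es ++ stars S ++ b)
      star-accepted (e ∷ es) (e∉ ∷ uq) es⊆ (here refl) =
        kruskal-accept e (es ++ stars S ++ b) (star-fresh ad clear {es} (es⊆ (here refl)) (λ e∈ → All.lookup e∉ e∈ refl) (es⊆ ∘ there))
      star-accepted (e ∷ es) (e∉ ∷ uq) es⊆ (there e∈) = kruskal-∷ e (es ++ stars S ++ b) (star-accepted es uq (es⊆ ∘ there) e∈)

  -- The red forest and its colouring.

  Touches : List Vertex → Edge (V G) → Set
  Touches L e = proj₁ e ∈ L ⊎ proj₂ e ∈ L

  touches? : ∀ L → Decidable (Touches L)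
  touches? L e = (proj₁ e ∈? L) ⊎-dec (proj₂ e ∈? L)

  missing : List Vertex → List (Edge (V G))
  missing L = filter (¬? ∘ touches? L) E

  touches⁺ : Ends e x y → y ∈ L → Touches L e
  touches⁺ (inj₁ refl) y∈ = inj₂ y∈
  touches⁺ (inj₂ refl) y∈ = inj₁ y∈

  ∈-missing⁻ : e ∈ missing L → e ∈ E × ¬ Touches L e
  ∈-missing⁻ {L = L} = ∈-filter⁻ (¬? ∘ touches? L) {xs = E}

  -- Kruskal reads the list from its end, so the edges missing `N S` come first. Edges that recur in
  -- `E` do no harm: once processed, their ends carry equal labels, and the second copy is rejected.
  priority : List Vertex → List (Edge (V G))
  priority S = E ++ stars S ++ missing (N S)

  reds : List Vertex → List (Edge (V G))
  reds S = kruskal (priority S)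

  missing-⊆-reds : ∀ S → kruskal (missing (N S)) ⊆ reds S
  missing-⊆-reds S e∈ = kruskal-++ʳ E (kruskal-++ʳ (stars S) e∈)

  stars-⊆-reds : Good S → stars S ⊆ reds S
  stars-⊆-reds {S} g e∈ = kruskal-++ʳ E (stars-accepted g clear e∈)
    where
    clear : ∀ {e} → e ∈ missing (N S) → Clear S e
    -- An edge with an end in `S` has its other end in `N S`, so an edge that misses `N S` avoids
    -- `S` as well.
    clear {e} e∈ {x} i = (λ x∈ → miss (touches⁺ ends (∈-N⁺ x∈ (∈-nbrs⁺ e∈E ends)))) , (λ x∈ → miss (touches⁺ (swap ends) x∈))
      where
      e∈E = proj₁ (∈-missing⁻ {L = N S} e∈)
      miss = proj₂ (∈-missing⁻ {L = N S} e∈)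
      ends = other-ends i

  reds-⊆ : ∀ S → reds S ⊆ E
  reds-⊆ S e∈ with ∈-++⁻ E (kruskal-⊆ (priority S) e∈)
  ... | inj₁ e∈E = e∈E
  ... | inj₂ e∈' with ∈-++⁻ (stars S) e∈'
  ...   | inj₂ e∈m = proj₁ (∈-missing⁻ {L = N S} e∈m)
  ...   | inj₁ e∈s with ∈-stars⁻ {S = S} e∈s
  ...     | s , _ , e∈s' = proj₁ (∈-star⁻ {v = s} e∈s')

  colour : List Vertex → Coloring G
  colour S i = does (lookup E i ∈E? reds S)

  red-joined : ∀ S → Adj G (colour S) red x y → Joined (reds S) x y
  red-joined S (i , ends , eq) with lookup E i ∈E? reds S
  ... | yes e∈ = lookup E i , e∈ , ends

  red-acyclic : ∀ S → ¬ CycleIn G (colour S) red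
  red-acyclic S (x , ys , 3≤ , uq , w , l) = kruskal-acyclic (priority S) x ys 3≤ uq (chain x ys w) (closing x ys l)
    where
    chain : ∀ x ys → Walk G (colour S) red (x ∷ ys) → Chain (reds S) (x ∷ ys)
    chain x []       _       = tt
    chain x (y ∷ ys) (j , w) = red-joined S j , chain y ys w
    closing : ∀ z ys → LastAdj G (colour S) red x ys → Joined (reds S) (last z ys) x
    closing z (y ∷ [])      l = red-joined S l
    closing z (y ∷ y' ∷ ys) l = closing y (y' ∷ ys) l

-- Trails and their edges.

module Path (G : Graph) where

  open Kruskal {V G}
  open Greedy G
  open import Data.List.Membership.DecPropositional (_≟_ {V G}) using (_∈?_)
  open import Data.List.Membership.DecPropositional (≡-dec (_≟_ {V G}) (_≟_ {V G})) using () renaming (_∈?_ to _∈E?_)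

  private
    variable
      e : Edge (V G)
      u v w x y z : Vertex
      S xs ys : List Vertex
      es : List (Edge (V G))

  -- The edges used appear as an index so that they can be filtered and counted.
  data Trail (R : Edge (V G) → Set) : Vertex → List Vertex → List (Edge (V G)) → Set where
    []   : Trail R x [] []
    step : R e → Ends e x y → Trail R y ys es → Trail R x (y ∷ ys) (e ∷ es)

  module _ {R : Edge (V G) → Set} where

    trail-length : Trail R x ys es → length es ≡ length ys
    trail-length []           = refl
    trail-length (step _ _ t) = cong suc (trail-length t)

    trail-edges : Trail R x ys es → e ∈ es → R e
    trail-edges (step r _ t) (here refl) = r
    trail-edges (step _ _ t) (there e∈)  = trail-edges t e∈

    trail-vertices : Trail R x ys es → e ∈ es → Incident z e → z ∈ x ∷ ys
    trail-vertices (step _ ends t) (here refl) i with incident-ends ends i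
    ... | inj₁ refl = here refl
    ... | inj₂ refl = there (here refl)
    trail-vertices (step _ _ t) (there e∈) i = there (trail-vertices t e∈ i)

    -- If the first edge recurred, its end `x` would recur among the later vertices.
    trail-unique : Trail R x ys es → Unique (x ∷ ys) → Unique es
    trail-unique []              _         = []
    trail-unique (step _ ends t) (x∉ ∷ uq) =
      fresh-∷ (λ e∈ → All.lookup x∉ (trail-vertices t e∈ (ends-incident ends)) refl) (trail-unique t uq)

    trail-edgeAt : Trail R x (y ∷ ys) es → z ∈ x ∷ y ∷ ys → ∃[ e ] (R e × Incident z e)
    trail-edgeAt (step r ends t)               (here refl)         = _ , r , ends-incident ends
    trail-edgeAt (step r ends t)               (there (here refl)) = _ , r , ends-incident (swap ends)
    trail-edgeAt (step _ _ t@(step _ _ _))     (there (there z∈))  = trail-edgeAt t (there z∈)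

    module _ {K : Edge (V G) → Set} (K? : Decidable K) where

      -- Each vertex entered by an edge in `K` hangs from its predecessor. Building from the far end
      -- of the path, the predecessor does not occur later and avoids `zs`, as `add` requires.
      trail-hanging : ∀ {ℓ zs} → (∀ {e} → R e → K e → Constant ℓ e) → Hanging ℓ zs →
        Trail R x ys es → Unique (x ∷ ys) → (∀ {z} → z ∈ x ∷ ys → z ∉ zs) →
        ∃[ ws ] (Hanging ℓ ws × (∀ {w} → w ∈ ws → w ∈ ys ⊎ w ∈ zs) × length ws ≡ length (filter K? es) + length zs)
      trail-hanging c h [] uq avoid = _ , h , inj₂ , refl
      trail-hanging {x = x} {ys = y ∷ _} {es = e ∷ _} {zs = zs} c h (step r ends t) (x∉ ∷ uq@(y∉ ∷ _)) avoid
        with trail-hanging c h t uq (avoid ∘ there) | K? e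
      ... | ws , h' , ws⊆ , eq | no  _ = ws , h' , (λ w∈ → map₁ there (ws⊆ w∈)) , eq
      ... | ws , h' , ws⊆ , eq | yes k = y ∷ ws , add x x∉' y∉' (constant⁻ _ ends (c r k)) h' , ⊆' , cong suc eq
        where
        y∉' : y ∉ ws
        y∉' y∈ with ws⊆ y∈
        ... | inj₁ y∈ys = All.lookup y∉ y∈ys refl
        ... | inj₂ y∈zs = avoid (there (here refl)) y∈zs
        x∉' : x ∉ y ∷ ws
        x∉' (here refl) = All.lookup x∉ (here refl) refl
        x∉' (there x∈) with ws⊆ x∈
        ... | inj₁ x∈ys = All.lookup x∉ (there x∈ys) refl
        ... | inj₂ x∈zs = avoid (here refl) x∈zs
        ⊆' : ∀ {w} → w ∈ y ∷ ws → w ∈ y ∷ _ ⊎ w ∈ zs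
        ⊆' (here refl) = inj₁ (here refl)
        ⊆' (there w∈)  = map₁ there (ws⊆ w∈)

      -- The second component, for a first vertex in M, carries the induction.
      trail-count : {M : Vertex → Set} (M? : Decidable M) →
        (∀ {e x y} → Ends e x y → ¬ M x → ¬ M y → K e) → Trail R x ys es →
        let bound = length (filter K? es) + 2 * length (filter M? (x ∷ ys)) in
        length ys ≤ bound × (M x → suc (length ys) ≤ bound)
      trail-count {x = x} M? κ [] with M? x
      ... | yes _ = z≤n , λ _ → s≤s z≤n
      ... | no  ¬m = z≤n , λ m → contradiction m ¬m
      trail-count {x = x} {ys = y ∷ ys} {es = e ∷ es} M? κ (step r ends t)
        with trail-count M? κ t | M? x | K? e
      ... | p , _  | yes _ | yes _ = ≤-trans (n≤1+n _) (m≤n⇒m≤1+n (twice-suc _ _ p)) , λ _ → m≤n⇒m≤1+n (twice-suc _ _ p)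
      ... | p , _  | yes _ | no  _ = ≤-trans (n≤1+n _) (twice-suc _ _ p) , λ _ → twice-suc _ _ p
      ... | p , _  | no ¬m | yes _ = s≤s p , λ m → contradiction m ¬m
      -- An edge outside `K` that leaves a vertex outside `M` must enter `M`; the stronger bound
      -- available at `y` pays for it.
      ... | _ , p' | no ¬m | no ¬k = p' (decidable-stable (M? y) λ ¬m' → ¬k (κ ends ¬m ¬m')) , λ m → contradiction m ¬m

  -- Bounds forced by a blue path.

  Blue : List Vertex → Edge (V G) → Set
  Blue S e = e ∈ E × e ∉ reds S

  blue-trail : ∀ S x ys → Walk G (colour S) blue (x ∷ ys) → ∃[ es ] Trail (Blue S) x ys es
  blue-trail S x []       _ = [] , []
  blue-trail S x (y ∷ ys) ((i , ends , eq) , w) with blue-trail S y ys w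
  ... | es , t = lookup E i ∷ es , step (∈-lookup i , e∉ eq) ends t
    where
    e∉ : colour S i ≡ false → lookup E i ∉ reds S
    e∉ eq e∈ = differ eq (dec-true (lookup E i ∈E? reds S) e∈) refl

  -- The alternatives are the ways in which a vertex of positive degree can fail to be `Admissible`.
  Maximal : ℕ → List Vertex → Set
  Maximal j S = ∀ {v} → 1 ≤ deg v → deg v ≤ j → v ∈ S ⊎ v ∈ N S ⊎ 2 ≤ length (edgesInto v (N S))

  high : ℕ → List Vertex → List Vertex
  high j = filter (λ v → j <? deg v)

  -- Each `s` hangs from any of its neighbours, which lies outside the list by independence.
  good-hanging : ∀ {S} → Good S → ∀ es → E ⊆ es → Hanging (label es) S
  good-hanging []                     es E⊆ = []
  good-hanging {s ∷ S} g@(ad ∷ g') es E⊆ with deg-∈ (deg≥1 ad)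
    where
    deg-∈ : 1 ≤ length (star s) → ∃[ e ] e ∈ star s
    deg-∈ 1≤ with star s
    ... | e ∷ _ = e , here refl
  ... | e , e∈ with ∈-star⁻ {v = s} e∈
  ...   | e∈E , ends = add (other s e) (λ o∈ → good-disjoint g o∈ (∈-++⁺ˡ (∈-nbrs⁺ e∈E ends))) (v∉S ad)
            (sym (constant⁻ (label es) ends (label-constant (E⊆ e∈E)))) (good-hanging g' es E⊆)

  module _ (good : Good S) (t : Trail (Blue S) x (y ∷ ys) es) (uq : Unique (x ∷ y ∷ ys)) where

    private
      m = length E
      k = length (y ∷ ys)
      L = N S
      path : List Vertex
      path = x ∷ y ∷ ys

    -- A vertex of the path lies on a blue edge, whereas all edges at a vertex of `S` are red.
    path-avoids : z ∈ path → z ∉ S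
    path-avoids z∈ z∈S with trail-edgeAt t z∈
    ... | e , (e∈ , e∉) , i = e∉ (stars-⊆-reds good (∈-concatMap⁺ star (lose z∈S (∈-filter⁺ (incident? _) e∈ i))))

    path-deg : z ∈ path → 1 ≤ deg z
    path-deg z∈ with trail-edgeAt t z∈
    ... | e , (e∈ , e∉) , i = filter-some (incident? _) (lose e∈ i)

    -- The path together with one edge at every vertex of S is a forest.
    good-size : k + k + length S ≤ m
    good-size
      with trail-hanging (λ _ → yes tt) (λ (e∈ , _) _ → label-constant (∈-++⁺ˡ e∈))
             (good-hanging good (priority S) ∈-++⁺ˡ) t uq path-avoids
    ... | ws , h , _ , eq = begin
        k + k + length S                ≡⟨ +-assoc k k (length S) ⟩
        k + (k + length S)              ≡⟨ cong (λ l → k + (l + length S)) (sym all-kept) ⟩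
        k + (length (filter (λ _ → yes tt) es) + length S) ≡⟨ cong (k +_) (sym eq) ⟩
        k + length ws                   ≤⟨ +-monoʳ-≤ k (hanging-length≤ (priority S) h) ⟩
        k + length (reds S)             ≡⟨ cong (_+ length (reds S)) (sym (trail-length t)) ⟩
        length es + length (reds S)     ≡⟨ sym (length-++ es) ⟩
        length (es ++ reds S)           ≤⟨ Unique-⊆⇒length≤ unique ⊆E ⟩
        m                               ∎
      where
      open ≤-Reasoning
      all-kept : length (filter (λ _ → yes tt) es) ≡ k
      all-kept = trans (cong length (filter-all (λ _ → yes tt) {es} (All.tabulate _))) (trail-length t)
      unique : Unique (es ++ reds S)
      unique = Unique.++⁺ (trail-unique t uq) (kruskal-unique (priority S)) λ (e∈ , e∈r) → proj₂ (trail-edges t e∈) e∈r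
      ⊆E : es ++ reds S ⊆ E
      ⊆E e∈ with ∈-++⁻ es e∈
      ... | inj₁ e∈es = proj₁ (trail-edges t e∈es)
      ... | inj₂ e∈r  = reds-⊆ S e∈r

    private
      miss? = ¬? ∘ touches? L
      q = length (filter miss? es)

    -- The `q` path edges that miss `L` form a forest. Kruskal treats the edges missing `L` first
    -- and accepts at least `q` of them; those are red, hence different from the blue ones.
    missing-size : q + q ≤ length (missing L)
    missing-size with trail-hanging miss? (λ (e∈ , _) miss → label-constant (∈-filter⁺ miss? e∈ miss)) [] t uq (λ _ ())
    ... | ws , h , _ , eq = begin
        q + q                                   ≡⟨ cong (q +_) (sym (trans eq (+-identityʳ q))) ⟩
        q + length ws                           ≤⟨ +-monoʳ-≤ q (hanging-length≤ (missing L) h) ⟩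
        q + length (kruskal (missing L))        ≡⟨ sym (length-++ (filter miss? es)) ⟩
        length (filter miss? es ++ kruskal (missing L)) ≤⟨ Unique-⊆⇒length≤ unique ⊆missing ⟩
        length (missing L)                      ∎
      where
      open ≤-Reasoning
      unique : Unique (filter miss? es ++ kruskal (missing L))
      unique = Unique.++⁺ (Unique.filter⁺ miss? (trail-unique t uq)) (kruskal-unique (missing L))
        λ (e∈ , e∈r) → proj₂ (trail-edges t (proj₁ (∈-filter⁻ miss? {xs = es} e∈))) (missing-⊆-reds S e∈r)
      ⊆missing : filter miss? es ++ kruskal (missing L) ⊆ missing L
      ⊆missing e∈ with ∈-++⁻ (filter miss? es) e∈
      ... | inj₂ e∈k = kruskal-⊆ (missing L) e∈k
      ... | inj₁ e∈f with ∈-filter⁻ miss? {xs = es} e∈f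
      ...   | e∈es , miss = ∈-filter⁺ miss? (proj₁ (trail-edges t e∈es)) miss

    length-∩-L : {zs : List Vertex} → Unique zs → length (filter (_∈? L) zs) ≤ length L
    length-∩-L {zs} u = Unique-⊆⇒length≤ (Unique.filter⁺ (_∈? L) u) (proj₂ ∘ ∈-filter⁻ (_∈? L) {xs = zs})

    -- Each vertex of `L` on the path accounts for at most two path edges that touch `L`.
    missing-steps : k ≤ q + 2 * length L
    missing-steps = ≤-trans (proj₁ (trail-count miss? (_∈? L) missed t)) (+-monoʳ-≤ q (*-monoʳ-≤ 2 (length-∩-L uq)))
      where
      missed : ∀ {e x y} → Ends e x y → x ∉ L → y ∉ L → ¬ Touches L e
      missed (inj₁ refl) x∉ y∉ = [ x∉ , y∉ ]
      missed (inj₂ refl) x∉ y∉ = [ y∉ , x∉ ]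

    private
      into : Vertex → List (Edge (V G))
      into v = edgesInto v L

    -- An edge counted from two vertices of `vs` would have both ends in `vs`, but one of its ends
    -- lies in `L`.
    into-unique : {vs : List Vertex} → Unique vs → (∀ {v} → v ∈ vs → v ∉ L) → Unique (concatMap into vs)
    into-unique []                    _    = []
    into-unique {v ∷ vs} (v∉ ∷ uq) vs∉L = Unique.++⁺ (edgesInto-unique v L) (into-unique uq (vs∉L ∘ there)) disjoint
      where
      disjoint : ∀ {e} → ¬ (e ∈ into v × e ∈ concatMap into vs)
      disjoint {e} (e∈ , e∈') with ∈-edgesInto⁻ {v = v} e∈ | find (∈-concatMap⁻ into {xs = vs} e∈')
      ... | e∈v , o∈L | w , w∈ , e∈w with ∈-star⁻ {v = v} e∈v | ∈-star⁻ {v = w} (proj₁ (∈-edgesInto⁻ {v = w} e∈w))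
      ...   | _ , ends | _ , ends' with incident-ends ends (ends-incident ends')
      ...     | inj₁ refl = All.lookup v∉ w∈ refl
      ...     | inj₂ refl = vs∉L (there w∈) o∈L

    into-⊆ : (vs : List Vertex) → concatMap into vs ⊆ filter (touches? L) E
    into-⊆ vs e∈ with find (∈-concatMap⁻ into {xs = vs} e∈)
    ... | w , w∈ , e∈w with ∈-edgesInto⁻ {v = w} e∈w
    ...   | e∈s , o∈L with ∈-star⁻ {v = w} e∈s
    ...     | e∈E , ends = ∈-filter⁺ (touches? L) e∈E (touches⁺ ends o∈L)

    length-into-S : (vs : List Vertex) → vs ⊆ S → length (concatMap into vs) ≡ length (stars vs)
    length-into-S []       _   = refl
    length-into-S (v ∷ vs) vs⊆ = trans (length-++ (into v)) (trans
      (cong₂ _+_ (cong length (filter-all (λ e → other v e ∈? L) all)) (length-into-S vs (vs⊆ ∘ there)))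
      (sym (length-++ (star v))))
      where
      all : All (λ e → other v e ∈ L) (star v)
      all = All.tabulate λ e∈ → ∈-N⁺ (vs⊆ (here refl)) (∈-map⁺ (other v) e∈)

    length-into : (vs : List Vertex) → (∀ {v} → v ∈ vs → 2 ≤ length (into v)) → 2 * length vs ≤ length (concatMap into vs)
    length-into []       _  = z≤n
    length-into (v ∷ vs) 2≤ = begin
        2 * suc (length vs)                       ≡⟨ *-suc 2 (length vs) ⟩
        2 + 2 * length vs                         ≤⟨ +-mono-≤ (2≤ (here refl)) (length-into vs (2≤ ∘ there)) ⟩
        length (into v) + length (concatMap into vs) ≡⟨ sym (length-++ (into v)) ⟩
        length (concatMap into (v ∷ vs))          ∎
      where open ≤-Reasoning

    module _ {j : ℕ} (maximal : Maximal j S) where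

      private
        high? : Decidable (λ v → j < deg v)
        high? v = j <? deg v
        low outer : List Vertex
        low = filter (¬? ∘ high?) path
        outer = filter (¬? ∘ (_∈? L)) low

      outer⁻ : v ∈ outer → v ∈ path × deg v ≤ j × v ∉ L
      outer⁻ v∈ with ∈-filter⁻ (¬? ∘ (_∈? L)) {xs = low} v∈
      ... | v∈low , v∉L with ∈-filter⁻ (¬? ∘ high?) {xs = path} v∈low
      ...   | v∈path , low = v∈path , ≮⇒≥ low , v∉L

      outer-into : v ∈ outer → 2 ≤ length (into v)
      outer-into v∈ with outer⁻ v∈
      ... | v∈path , d≤j , v∉L with maximal (path-deg v∈path) d≤j
      ...   | inj₁ v∈S        = contradiction v∈S (path-avoids v∈path)
      ...   | inj₂ (inj₁ v∈L) = contradiction v∈L v∉L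
      ...   | inj₂ (inj₂ 2≤)  = 2≤

      -- `S` and `outer` are disjoint and avoid `L`, so no edge into `L` is counted twice: the stars
      -- of `S` supply σ of them, and each vertex of `outer` at least two.
      touching-size : length L + 2 * length outer ≤ length (filter (touches? L) E)
      touching-size = begin
          length L + 2 * length outer                          ≤⟨ +-monoʳ-≤ (length L) (length-into outer outer-into) ⟩
          length L + length (concatMap into outer)
            ≡⟨ cong (_+ length (concatMap into outer)) (trans (length-N S) (sym (length-into-S S (λ v∈ → v∈)))) ⟩
          length (concatMap into S) + length (concatMap into outer) ≡⟨ sym (length-++ (concatMap into S)) ⟩
          length (concatMap into S ++ concatMap into outer)    ≡⟨ cong length (sym (concatMap-++ into S outer)) ⟩
          length (concatMap into (S ++ outer))                 ≤⟨ Unique-⊆⇒length≤ (into-unique unique avoid) (into-⊆ (S ++ outer)) ⟩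
          length (filter (touches? L) E)                       ∎
        where
        open ≤-Reasoning
        unique : Unique (S ++ outer)
        unique = Unique.++⁺ (good-unique good) (Unique.filter⁺ (¬? ∘ (_∈? L)) (Unique.filter⁺ (¬? ∘ high?) uq))
          λ (v∈S , v∈o) → path-avoids (proj₁ (outer⁻ v∈o)) v∈S
        avoid : ∀ {v} → v ∈ S ++ outer → v ∉ L
        avoid v∈ with ∈-++⁻ S v∈
        ... | inj₁ v∈S = good-disjoint good v∈S
        ... | inj₂ v∈o = proj₂ (proj₂ (outer⁻ v∈o))

      path-split : suc k ≤ length (high j (allFin (V G))) + (length L + length outer)
      path-split = begin
          suc k                                          ≡⟨ length-filter-¬ high? path ⟩
          length (filter high? path) + length low        ≡⟨ cong (length (filter high? path) +_) (length-filter-¬ (_∈? L) low) ⟩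
          length (filter high? path) + (length (filter (_∈? L) low) + length outer)
            ≤⟨ +-mono-≤ (Unique-⊆⇒length≤ (Unique.filter⁺ high? uq) high⊆)
                 (+-monoˡ-≤ (length outer) (length-∩-L (Unique.filter⁺ (¬? ∘ high?) uq))) ⟩
          length (high j (allFin (V G))) + (length L + length outer) ∎
        where
        open ≤-Reasoning
        high⊆ : filter high? path ⊆ high j (allFin (V G))
        high⊆ v∈ = ∈-filter⁺ high? (∈-allFin _) (proj₂ (∈-filter⁻ high? {xs = path} v∈))

      -- `path-split` and `missing-steps` are each used twice; the edges touching `L` and those
      -- missing `L` then add up to `m`.
      level-bound : 4 * suc k ≤ m + 5 * length L + 2 * length (high j (allFin (V G))) + 2
      level-bound = begin
          4 * suc k                               ≡⟨ eq₁ k ⟩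
          2 * suc k + (2 * k + 2)                 ≤⟨ +-mono-≤ (*-monoʳ-≤ 2 path-split) (+-monoˡ-≤ 2 (*-monoʳ-≤ 2 missing-steps)) ⟩
          2 * (g + (σ + o)) + (2 * (q + 2 * σ) + 2) ≡⟨ eq₂ g σ o q ⟩
          (σ + 2 * o) + (q + q) + 5 * σ + 2 * g + 2
            ≤⟨ +-monoˡ-≤ 2 (+-monoˡ-≤ (2 * g) (+-monoˡ-≤ (5 * σ) (+-mono-≤ touching-size missing-size))) ⟩
          length (filter (touches? L) E) + length (missing L) + 5 * σ + 2 * g + 2
            ≡⟨ cong (λ l → l + 5 * σ + 2 * g + 2) (sym (length-filter-¬ (touches? L) E)) ⟩
          m + 5 * σ + 2 * g + 2                   ∎
        where
        open ≤-Reasoning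
        σ = length L
        g = length (high j (allFin (V G)))
        o = length outer
        eq₁ : ∀ k → 4 * suc k ≡ 2 * suc k + (2 * k + 2)
        eq₁ = solve-∀
        eq₂ : ∀ g σ o q → 2 * (g + (σ + o)) + (2 * (q + 2 * σ) + 2) ≡ (σ + 2 * o) + (q + q) + 5 * σ + 2 * g + 2
        eq₂ = solve-∀

-- Greedy growth through the degree levels.

module Levels (G : Graph) where

  open Greedy G
  open Path G
  open import Data.List.Membership.DecPropositional (_≟_ {V G}) using (_∈?_)

  admissible? : ∀ S v → Dec (Admissible S v)
  admissible? S v = map′ (λ (a , b , c , d) → admissible a b c d) (λ a → v∉S a , v∉N a , oneInto a , deg≥1 a)
    (¬? (v ∈? S) ×-dec ¬? (v ∈? N S) ×-dec (length (edgesInto v (N S)) ≤? 1) ×-dec (1 ≤? deg v))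

  extend : ℕ → List Vertex → List Vertex → List Vertex
  extend j S []       = S
  extend j S (v ∷ vs) with admissible? (extend j S vs) v ×-dec (deg v ≤? j)
  ... | yes _ = v ∷ extend j S vs
  ... | no  _ = extend j S vs

  extend-good : ∀ j {S} vs → Good S → Good (extend j S vs)
  extend-good j     []       g = g
  extend-good j {S} (v ∷ vs) g with admissible? (extend j S vs) v ×-dec (deg v ≤? j)
  ... | yes (ad , _) = ad ∷ extend-good j vs g
  ... | no  _        = extend-good j vs g

  -- Every accepted vertex adds at most `j` to the degree sum; the inequality is arranged to avoid
  -- subtraction.
  extend-size : ∀ j S vs → length (N (extend j S vs)) + j * length S ≤ length (N S) + j * length (extend j S vs)
  extend-size j S []       = ≤-refl
  extend-size j S (v ∷ vs) with admissible? (extend j S vs) v ×-dec (deg v ≤? j)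
  ... | no  _         = extend-size j S vs
  ... | yes (_ , d≤j) = begin
      length (nbrs v ++ N S') + j * length S
        ≡⟨ cong (_+ j * length S) (trans (length-++ (nbrs v)) (cong (_+ length (N S')) (length-map (other v) (star v)))) ⟩
      deg v + length (N S') + j * length S             ≡⟨ +-assoc (deg v) _ _ ⟩
      deg v + (length (N S') + j * length S)           ≤⟨ +-mono-≤ d≤j (extend-size j S vs) ⟩
      j + (length (N S) + j * length S')               ≡⟨ eq j (length (N S)) (length S') ⟩
      length (N S) + j * suc (length S')               ∎
    where
    open ≤-Reasoning
    S' = extend j S vs
    eq : ∀ j n s → j + (n + j * s) ≡ n + j * suc s
    eq = solve-∀

  Rejected : List Vertex → Vertex → Set
  Rejected S v = v ∈ S ⊎ v ∈ N S ⊎ 2 ≤ length (edgesInto v (N S))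

  -- Rejection is permanent because `S` and `N S` only grow, so a single pass over the vertices
  -- reaches maximality.
  rejected-∷ : ∀ {S v} w → Rejected S v → Rejected (w ∷ S) v
  rejected-∷ w (inj₁ v∈S)        = inj₁ (there v∈S)
  rejected-∷ w (inj₂ (inj₁ v∈N)) = inj₂ (inj₁ (∈-++⁺ʳ (nbrs w) v∈N))
  rejected-∷ {S} {v} w (inj₂ (inj₂ 2≤))  = inj₂ (inj₂ (≤-trans 2≤ (Unique-⊆⇒length≤ (edgesInto-unique v (N S)) more)))
    where
    more : edgesInto v (N S) ⊆ edgesInto v (N (w ∷ S))
    more e∈ with ∈-edgesInto⁻ {v = v} {N S} e∈
    ... | e∈s , o∈ with ∈-star⁻ {v = v} e∈s
    ...   | e∈E , ends = ∈-edgesInto⁺ e∈E ends (∈-++⁺ʳ (nbrs w) o∈)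

  rejected : ∀ {S v} → 1 ≤ deg v → ¬ Admissible S v → Rejected S v
  rejected {S} {v} 1≤ ¬ad with v ∈? S | v ∈? N S | length (edgesInto v (N S)) ≤? 1
  ... | yes v∈S | _       | _      = inj₁ v∈S
  ... | no  _   | yes v∈N | _      = inj₂ (inj₁ v∈N)
  ... | no  _   | no  _   | no  ≰1 = inj₂ (inj₂ (≰⇒> ≰1))
  ... | no  v∉S | no  v∉N | yes ≤1 = contradiction (admissible v∉S v∉N ≤1 1≤) ¬ad

  extend-rejected : ∀ j S vs {v} → v ∈ vs → 1 ≤ deg v → deg v ≤ j → Rejected (extend j S vs) v
  extend-rejected j S (w ∷ vs) v∈ 1≤ ≤j with admissible? (extend j S vs) w ×-dec (deg w ≤? j)
  extend-rejected j S (w ∷ vs) (here refl) 1≤ ≤j | yes _  = inj₁ (here refl)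
  extend-rejected j S (w ∷ vs) (there v∈)  1≤ ≤j | yes _  = rejected-∷ w (extend-rejected j S vs v∈ 1≤ ≤j)
  extend-rejected j S (w ∷ vs) (here refl) 1≤ ≤j | no  ¬p = rejected 1≤ λ ad → ¬p (ad , ≤j)
  extend-rejected j S (w ∷ vs) (there v∈)  1≤ ≤j | no  _  = extend-rejected j S vs v∈ 1≤ ≤j

  level : ℕ → List Vertex → List Vertex
  level j S = extend j S (allFin (V G))

  level-maximal : ∀ j S → Maximal j (level j S)
  level-maximal j S = extend-rejected j S (allFin (V G)) (∈-allFin _)

  -- The sets are nested, with vertices of small degree taken first, so that the degree sum stays
  -- small relative to the number of vertices.
  S₂ S₄ S₇ : List Vertex
  S₂ = level 2 []
  S₄ = level 4 S₂
  S₇ = level 7 S₄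

  good₂ : Good S₂
  good₂ = extend-good 2 (allFin (V G)) []

  good₄ : Good S₄
  good₄ = extend-good 4 (allFin (V G)) good₂

  good₇ : Good S₇
  good₇ = extend-good 7 (allFin (V G)) good₄

  -- Counting vertices of high degree.

  #high : ℕ → ℕ
  #high j = length (high j (allFin (V G)))

  -- The partial sums 3, 5, 8 of the weights are exactly the least degrees above the thresholds 2,
  -- 4, 7.
  weight : ∀ d → 3 * indicator (2 <? d) + 2 * indicator (4 <? d) + 3 * indicator (7 <? d) ≤ d
  weight 0 = z≤n
  weight 1 = z≤n
  weight 2 = z≤n
  weight 3 = ≤-refl
  weight 4 = n≤1+n 3
  weight 5 = ≤-refl
  weight 6 = m≤m+n 5 1
  weight 7 = m≤m+n 5 2
  weight (suc (suc (suc (suc (suc (suc (suc (suc d)))))))) = m≤m+n 8 d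

  high-≤-degrees : ∀ vs → 3 * length (high 2 vs) + 2 * length (high 4 vs) + 3 * length (high 7 vs) ≤ sum (map deg vs)
  high-≤-degrees []       = z≤n
  high-≤-degrees (v ∷ vs) = begin
      3 * length (high 2 (v ∷ vs)) + 2 * length (high 4 (v ∷ vs)) + 3 * length (high 7 (v ∷ vs))
        ≡⟨ cong₂ _+_ (cong₂ _+_ (cong (3 *_) (∷-high 2)) (cong (2 *_) (∷-high 4))) (cong (3 *_) (∷-high 7)) ⟩
      3 * (i₂ + length (high 2 vs)) + 2 * (i₄ + length (high 4 vs)) + 3 * (i₇ + length (high 7 vs))
        ≡⟨ eq i₂ i₄ i₇ (length (high 2 vs)) (length (high 4 vs)) (length (high 7 vs)) ⟩
      (3 * i₂ + 2 * i₄ + 3 * i₇) + (3 * length (high 2 vs) + 2 * length (high 4 vs) + 3 * length (high 7 vs))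
        ≤⟨ +-mono-≤ (weight (deg v)) (high-≤-degrees vs) ⟩
      sum (map deg (v ∷ vs)) ∎
    where
    open ≤-Reasoning
    i₂ = indicator (2 <? deg v)
    i₄ = indicator (4 <? deg v)
    i₇ = indicator (7 <? deg v)
    ∷-high : ∀ j → length (high j (v ∷ vs)) ≡ indicator (j <? deg v) + length (high j vs)
    ∷-high j = length-filter-∷ (λ v → j <? deg v) v vs
    eq : ∀ a b c d e f → 3 * (a + d) + 2 * (b + e) + 3 * (c + f) ≡ (3 * a + 2 * b + 3 * c) + (3 * d + 2 * e + 3 * f)
    eq = solve-∀

  incident-twice : ∀ (e : Edge (V G)) {vs} → Unique vs → length (filter (λ v → incident? v e) vs) ≤ 2
  incident-twice e {vs} uq = Unique-⊆⇒length≤ (Unique.filter⁺ (λ v → incident? v e) uq) ends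
    where
    ends : filter (λ v → incident? v e) vs ⊆ proj₁ e ∷ proj₂ e ∷ []
    ends v∈ with proj₂ (∈-filter⁻ (λ v → incident? v e) {xs = vs} v∈)
    ... | inj₁ refl = here refl
    ... | inj₂ refl = there (here refl)

  -- Double counting by induction on the edges: each edge contributes to at most two vertices.
  handshake : ∀ es {vs} → Unique vs → sum (map (λ v → length (filter (incident? v) es)) vs) ≤ 2 * length es
  handshake []       {vs} uq = ≤-reflexive (zeros vs)
    where
    zeros : ∀ vs → sum (map (λ v → length (filter (incident? v) [])) vs) ≡ 0
    zeros []       = refl
    zeros (_ ∷ vs) = zeros vs
  handshake (e ∷ es) {vs} uq = begin
      sum (map (λ v → length (filter (incident? v) (e ∷ es))) vs)  ≡⟨ split vs ⟩
      length (filter (λ v → incident? v e) vs) + sum (map (λ v → length (filter (incident? v) es)) vs)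
                                                                    ≤⟨ +-mono-≤ (incident-twice e uq) (handshake es uq) ⟩
      2 + 2 * length es                                             ≡⟨ sym (*-suc 2 (length es)) ⟩
      2 * length (e ∷ es)                                           ∎
    where
    open ≤-Reasoning
    split : ∀ vs → sum (map (λ v → length (filter (incident? v) (e ∷ es))) vs)
                 ≡ length (filter (λ v → incident? v e) vs) + sum (map (λ v → length (filter (incident? v) es)) vs)
    split []       = refl
    split (v ∷ vs) rewrite length-filter-∷ (incident? v) e es | length-filter-∷ (λ v → incident? v e) v vs | split vs =
      interchange (indicator (incident? v e)) (length (filter (incident? v) es)) (length (filter (λ v → incident? v e) vs)) _
      where
      interchange : ∀ a b c d → (a + b) + (c + d) ≡ (a + c) + (b + d)
      interchange = solve-∀

  #high-≤ : 3 * #high 2 + 2 * #high 4 + 3 * #high 7 ≤ 2 * ∣E∣ G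
  #high-≤ = ≤-trans (high-≤-degrees (allFin (V G))) (handshake E (Unique.allFin⁺ (V G)))

  -- The path has `n` vertices but one edge fewer, which accounts for the 2 added to the first
  -- bound.
  path-bounds : ∀ {S n} → Good S → 2 ≤ n → PathOn G (colour S) blue n →
    2 * n + length S ≤ ∣E∣ G + 2 × (∀ {j} → Maximal j S → 4 * n ≤ ∣E∣ G + 5 * length (N S) + 2 * #high j + 2)
  path-bounds g () ([] , refl , _)
  path-bounds g (s≤s ()) (_ ∷ [] , refl , _)
  path-bounds {S} g _ (x ∷ y ∷ ys , refl , uq , w) with blue-trail S x (y ∷ ys) w
  ... | es , t = ≤-trans (≤-reflexive (eq (length (y ∷ ys)) (length S))) (+-monoˡ-≤ 2 (good-size g t uq)) , level-bound g t uq
    where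
    eq : ∀ k s → 2 * suc k + s ≡ k + k + s + 2
    eq = solve-∀

-- Arithmetic of the combined bounds.

sizes-≤ : ∀ σ₂ σ₄ σ₇ s₂ s₄ s₇ → σ₂ + 2 * 0 ≤ 0 + 2 * s₂ → σ₄ + 4 * s₂ ≤ σ₂ + 4 * s₄ → σ₇ + 7 * s₄ ≤ σ₄ + 7 * s₇ →
  3 * σ₂ + 2 * σ₄ + 3 * σ₇ ≤ 21 * s₇
sizes-≤ σ₂ σ₄ σ₇ s₂ s₄ s₇ h₂ h₄ h₇ = +-cancelʳ-≤ X _ _ (begin
    3 * σ₂ + 2 * σ₄ + 3 * σ₇ + X ≡⟨ eq₁ σ₂ σ₄ σ₇ s₂ s₄ ⟩
    -- The multipliers 8 = 3 + 2 + 3, 5 = 2 + 3 and 3 are the total weights of the degree sums in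
    -- which a vertex added at level 2, 4 or 7 is counted.
    8 * (σ₂ + 2 * 0) + 5 * (σ₄ + 4 * s₂) + 3 * (σ₇ + 7 * s₄)
      ≤⟨ +-mono-≤ (+-mono-≤ (*-monoʳ-≤ 8 h₂) (*-monoʳ-≤ 5 h₄)) (*-monoʳ-≤ 3 h₇) ⟩
    -- A vertex added at level 2, 4 or 7 costs at most 8 * 2 = 16, 5 * 4 = 20 or 3 * 7 = 21. Against
    -- 21 throughout, the slack is 5 for each of the first kind and 1 for each of the second.
    8 * (0 + 2 * s₂) + 5 * (σ₂ + 4 * s₄) + 3 * (σ₄ + 7 * s₇) ≤⟨ m≤m+n _ (4 * s₂ + s₄) ⟩
    8 * (0 + 2 * s₂) + 5 * (σ₂ + 4 * s₄) + 3 * (σ₄ + 7 * s₇) + (4 * s₂ + s₄) ≡⟨ eq₂ σ₂ σ₄ s₂ s₄ s₇ ⟩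
    21 * s₇ + X ∎)
  where
  open ≤-Reasoning
  X = 5 * σ₂ + 3 * σ₄ + 20 * s₂ + 21 * s₄
  eq₁ : ∀ σ₂ σ₄ σ₇ s₂ s₄ → 3 * σ₂ + 2 * σ₄ + 3 * σ₇ + (5 * σ₂ + 3 * σ₄ + 20 * s₂ + 21 * s₄) ≡
    8 * (σ₂ + 2 * 0) + 5 * (σ₄ + 4 * s₂) + 3 * (σ₇ + 7 * s₄)
  eq₁ = solve-∀
  eq₂ : ∀ σ₂ σ₄ s₂ s₄ s₇ → 8 * (0 + 2 * s₂) + 5 * (σ₂ + 4 * s₄) + 3 * (σ₄ + 7 * s₇) + (4 * s₂ + s₄) ≡
    21 * s₇ + (5 * σ₂ + 3 * σ₄ + 20 * s₂ + 21 * s₄)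
  eq₂ = solve-∀

-- The factor 105 = 5 * 21 makes the terms in `s` cancel. The coefficients are 242 = 8 * 4 + 105 * 2
-- and 117 = 8 + 105 + 4.
combine : ∀ n m s σ₂ σ₄ σ₇ g₂ g₄ g₇ →
  3 * σ₂ + 2 * σ₄ + 3 * σ₇ ≤ 21 * s → 3 * g₂ + 2 * g₄ + 3 * g₇ ≤ 2 * m → 2 * n + s ≤ m + 2 →
  4 * n ≤ m + 5 * σ₂ + 2 * g₂ + 2 → 4 * n ≤ m + 5 * σ₄ + 2 * g₄ + 2 → 4 * n ≤ m + 5 * σ₇ + 2 * g₇ + 2 →
  242 * n ≤ 117 * m + 226
combine n m s σ₂ σ₄ σ₇ g₂ g₄ g₇ hσ hg hs h₂ h₄ h₇ = +-cancelʳ-≤ (105 * s) _ _ (begin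
    242 * n + 105 * s ≡⟨ eq₁ n s ⟩
    3 * (4 * n) + 2 * (4 * n) + 3 * (4 * n) + 105 * (2 * n + s)
      ≤⟨ +-mono-≤ (+-mono-≤ (+-mono-≤ (*-monoʳ-≤ 3 h₂) (*-monoʳ-≤ 2 h₄)) (*-monoʳ-≤ 3 h₇)) (*-monoʳ-≤ 105 hs) ⟩
    3 * (m + 5 * σ₂ + 2 * g₂ + 2) + 2 * (m + 5 * σ₄ + 2 * g₄ + 2) + 3 * (m + 5 * σ₇ + 2 * g₇ + 2) + 105 * (m + 2)
      ≡⟨ eq₂ m σ₂ σ₄ σ₇ g₂ g₄ g₇ ⟩
    5 * (3 * σ₂ + 2 * σ₄ + 3 * σ₇) + 2 * (3 * g₂ + 2 * g₄ + 3 * g₇) + (113 * m + 226)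
      ≤⟨ +-monoˡ-≤ (113 * m + 226) (+-mono-≤ (*-monoʳ-≤ 5 hσ) (*-monoʳ-≤ 2 hg)) ⟩
    5 * (21 * s) + 2 * (2 * m) + (113 * m + 226) ≡⟨ eq₃ m s ⟩
    117 * m + 226 + 105 * s ∎)
  where
  open ≤-Reasoning
  eq₁ : ∀ n s → 242 * n + 105 * s ≡ 3 * (4 * n) + 2 * (4 * n) + 3 * (4 * n) + 105 * (2 * n + s)
  eq₁ = solve-∀
  eq₂ : ∀ m σ₂ σ₄ σ₇ g₂ g₄ g₇ →
    3 * (m + 5 * σ₂ + 2 * g₂ + 2) + 2 * (m + 5 * σ₄ + 2 * g₄ + 2) + 3 * (m + 5 * σ₇ + 2 * g₇ + 2) + 105 * (m + 2) ≡
    5 * (3 * σ₂ + 2 * σ₄ + 3 * σ₇) + 2 * (3 * g₂ + 2 * g₄ + 3 * g₇) + (113 * m + 226)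
  eq₂ = solve-∀
  eq₃ : ∀ m s → 5 * (21 * s) + 2 * (2 * m) + (113 * m + 226) ≡ 117 * m + 226 + 105 * s
  eq₃ = solve-∀

-- Eliminating `m` leaves 651 * 242 - 117 * 1345 = 177 copies of `n`, bounded by 651 * 226 = 147126.
too-few-edges : ∀ {n m} → 1000 ≤ n → 651 * (m + 0) ≤ 1345 * n → ¬ 242 * n ≤ 117 * m + 226
-- The sum 29873 + 147126 is one less than 177 * 1000.
too-few-edges {n} {m} n≥ few h = <⇒≱ (*-monoʳ-≤ 177 n≥) (≤-trans small (m≤n+m 147126 29873))
  where
  open ≤-Reasoning
  small : 177 * n ≤ 147126
  small = +-cancelˡ-≤ (157365 * n) _ _ (begin
    157365 * n + 177 * n       ≡⟨ sym (*-distribʳ-+ n 157365 177) ⟩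
    157542 * n                 ≡⟨ *-assoc 651 242 n ⟩
    651 * (242 * n)            ≤⟨ *-monoʳ-≤ 651 h ⟩
    651 * (117 * m + 226)      ≡⟨ *-distribˡ-+ 651 (117 * m) 226 ⟩
    651 * (117 * m) + 147126   ≡⟨ cong (_+ 147126) (trans (sym (*-assoc 651 117 m)) (*-assoc 117 651 m)) ⟩
    117 * (651 * m) + 147126   ≤⟨ +-monoˡ-≤ 147126 (*-monoʳ-≤ 117 (subst (λ l → 651 * l ≤ 1345 * n) (+-identityʳ m) few)) ⟩
    117 * (1345 * n) + 147126  ≡⟨ cong (_+ 147126) (sym (*-assoc 117 1345 n)) ⟩
    157365 * n + 147126        ∎)

-- Choosing the colouring.

module _ (G : Graph) (n : ℕ) (n≥1000 : 1000 ≤ n) where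

  open Greedy G
  open Path G
  open Levels G

  private
    2≤n : 2 ≤ n
    2≤n = ≤-trans (m≤m+n 2 998) n≥1000

    m = ∣E∣ G

    Bound : List Vertex → ℕ → Set
    Bound S j = 4 * n ≤ m + 5 * length (N S) + 2 * #high j + 2

    bound? : ∀ S j → Dec (Bound S j)
    bound? S j = 4 * n ≤? m + 5 * length (N S) + 2 * #high j + 2

    violated : ∀ {S j} → Good S → Maximal j S → ¬ Bound S j → ∃[ c ] (¬ CycleIn G c red × ¬ PathOn G c blue n)
    violated {S} good maximal ¬b = colour S , red-acyclic S , λ p → ¬b (proj₂ (path-bounds good 2≤n p) maximal)

  -- Only four numerical inequalities are decided, and no search for paths is made: one that fails
  -- names a colouring without a blue path, and if all hold, then `combine` contradicts `few`.
  avoiding-colouring : 651 * (∣E∣ G + 0) ≤ 1345 * n → ∃[ c ] (¬ CycleIn G c red × ¬ PathOn G c blue n)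
  avoiding-colouring few with 2 * n + length S₇ ≤? m + 2 | bound? S₂ 2 | bound? S₄ 4 | bound? S₇ 7
  ... | no ¬s | _      | _      | _      = colour S₇ , red-acyclic S₇ , λ p → ¬s (proj₁ (path-bounds good₇ 2≤n p))
  ... | yes _ | no ¬b₂ | _      | _      = violated good₂ (level-maximal 2 []) ¬b₂
  ... | yes _ | yes _  | no ¬b₄ | _      = violated good₄ (level-maximal 4 S₂) ¬b₄
  ... | yes _ | yes _  | yes _  | no ¬b₇ = violated good₇ (level-maximal 7 S₄) ¬b₇
  ... | yes s | yes b₂ | yes b₄ | yes b₇ = ⊥-elim (too-few-edges {n} {m} n≥1000 few
        (combine n m (length S₇) (length (N S₂)) (length (N S₄)) (length (N S₇)) (#high 2) (#high 4) (#high 7)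
          (sizes-≤ (length (N S₂)) (length (N S₄)) (length (N S₇)) (length S₂) (length S₄) (length S₇)
            (extend-size 2 [] vs) (extend-size 4 S₂ vs) (extend-size 7 S₄ vs))
          #high-≤ s b₂ b₄ b₇))
    where vs = allFin (V G)

theorem1p4 : ∃[ C ] ∃[ N ] ∀ (n : ℕ) → n ≥ N →
    (∀ (G : Graph) → 651 * (∣E∣ G + C) ≤ 1345 * n →
    ∃[ c ] (¬ CycleIn G c red × ¬ PathOn G c blue n))
    × (2066 * 651 * n + 1000 * 651 * C < 1000 * 1345 * n)
    × (∀ (G : Graph) → Arrows G n → 1345 * n ≤ 651 * (∣E∣ G + C))
theorem1p4 = 0 , 1000 , λ n n≥1000 →
    (λ G → avoiding-colouring G n n≥1000)
  -- Here 2066 * 651 = 1344966, which is 34 below 1345000; strictness uses that `n` is positive.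
  , subst (_< 1345000 * n) (sym (+-identityʳ (1344966 * n)))
      (*-monoˡ-< n {{>-nonZero (≤-trans (m≤m+n 1 999) n≥1000)}} (m≤m+n 1344967 33))
  , λ G arrows → ≮⇒≥ λ few → refute arrows (avoiding-colouring G n n≥1000 (<⇒≤ few))
  where
  refute : ∀ {G n} → Arrows G n → ¬ (∃[ c ] (¬ CycleIn G c red × ¬ PathOn G c blue n))
  refute arrows (c , ¬cycle , ¬path) = [ ¬cycle , ¬path ] (arrows c)
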